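{- Let $A$ be a finite alphabet and let $\mathtt a \in A$. The positive $\Sigma_2$ fragment of the theory of word equations over $A^*$, restricted to word equations containing only the terminal symbol $\mathtt a$, augmented with the $\mathrm{Length}$ predicate, is decidable.
   Context: A word equation is a formal equality $U=V$ of words over constants and variables; here only the constant $\mathtt a$ may occur in equations, while variables range over all of $A^*$. An assignment (extended to a morphism fixing $A$) satisfies $U=V$ if the images of $U$ and $V$ coincide. $\mathrm{Length}(z_1,z_2)$ is true iff $|z_1|=|z_2|$; its arguments are variables or constant words from $A^*$. The positive $\Sigma_2$ fragment consists of sentences $\exists x_1,\ldots,x_n.\forall y_1,\ldots,y_m.\,\phi'$ with $\phi'$ built from atoms (here: word equations containing only the terminal $\mathtt a$, and $\mathrm{Length}$ atoms, over the variables $x_i,y_j$) using only conjunction and disjunction. Decidable means that there is an algorithm deciding the truth of such sentences in $A^*$. -}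

module Defs where

open import Data.Fin.Base using (Fin)
open import Data.List.Base using (List; [_]; concatMap; length)
open import Data.List.Membership.Propositional using (_∈_)
open import Data.Nat.Base using (ℕ)
open import Data.Product.Base using (Σ-syntax; _×_)
open import Data.Sum.Base using (_⊎_; inj₁; inj₂; [_,_]′)
open import Data.Unit.Base using (⊤)
open import Function.Base using (id)
open import Relation.Binary.PropositionalEquality.Core using (_≡_)

Word : Set → Set
Word A = List A

-- Words over terminals from A (inj₁) and variables from X (inj₂).
Pattern : Set → Set → Set
Pattern A X = List (A ⊎ X)

infix  6 _≐_
infixr 5 _∧_
infixr 4 _∨_

data PositiveFormula (A X : Set) : Set where
  _≐_    : (U V : Pattern A X) → PositiveFormula A X
  Length : (z₁ z₂ : X ⊎ Word A) → PositiveFormula A X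
  _∧_    : (φ ψ : PositiveFormula A X) → PositiveFormula A X
  _∨_    : (φ ψ : PositiveFormula A X) → PositiveFormula A X

Assignment : Set → Set → Set
Assignment A X = X → Word A

-- The extension of an assignment to a monoid morphism (A ∪ X)* → A* fixing A.
extend : ∀ {A X} → Assignment A X → Pattern A X → Word A
extend h = concatMap [ [_] , h ]′

infix 3 _⊨_
_⊨_ : ∀ {A X} → Assignment A X → PositiveFormula A X → Set
h ⊨ U ≐ V        = extend h U ≡ extend h V
h ⊨ Length z₁ z₂ = length ([ h , id ]′ z₁) ≡ length ([ h , id ]′ z₂)
h ⊨ φ ∧ ψ        = (h ⊨ φ) × (h ⊨ ψ)
h ⊨ φ ∨ ψ        = (h ⊨ φ) ⊎ (h ⊨ ψ)

-- The constant words occurring in Length atoms are deliberately unrestricted.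
EquationsOnlyUse : ∀ {A X} → A → PositiveFormula A X → Set
EquationsOnlyUse a (U ≐ V)        = (∀ {c} → inj₁ c ∈ U → c ≡ a) ×
                                    (∀ {c} → inj₁ c ∈ V → c ≡ a)
EquationsOnlyUse a (Length z₁ z₂) = ⊤
EquationsOnlyUse a (φ ∧ ψ)        = EquationsOnlyUse a φ × EquationsOnlyUse a ψ
EquationsOnlyUse a (φ ∨ ψ)        = EquationsOnlyUse a φ × EquationsOnlyUse a ψ

-- ∃ x₁ … xₙ. ∀ y₁ … yₘ. matrix, where inj₁ i stands for xᵢ and inj₂ j for yⱼ.
record PositiveΣ₂Sentence (A : Set) : Set where
  constructor ∃∀
  field
    n m    : ℕ
    matrix : PositiveFormula A (Fin n ⊎ Fin m)

open PositiveΣ₂Sentence public using (matrix)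

-- Truth of the sentence in A*.
True : ∀ {A} → PositiveΣ₂Sentence A → Set
True {A} (∃∀ n m φ) =
  Σ[ x ∈ Assignment A (Fin n) ] ((y : Assignment A (Fin m)) → [ x , y ]′ ⊨ φ)

{-# OPTIONS --safe #-}
module Submission where

-- Fix x and let the universal variable y_j stand for a^(K^(j+1) - 1) b with b ≠ a and K
-- exceeding the size of the formula at x. Lengths are then read off in base K and the words form
-- a code, so an atom true at this y is true at every y: the quantifier ∀ y distributes over
-- disjunction, and an equation holds for all y iff it holds when every y_j is a fresh letter.
-- Identifying all terminals with a preserves this, so x may be taken in a*; each atom becomes
-- a conjunction of linear equations over ℕ in the lengths of x. (Over a one-letter alphabet
-- every equation is an equation between lengths.) Positive combinations of linear equations
-- are recognized by finite automata reading binary digits, least significant first, with the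
-- carries as states, and emptiness of an automaton is decidable.

open import Defs
open import Data.Bool.Base using (Bool; true; false)
open import Data.Empty using (⊥)
open import Data.Fin.Base using (Fin; zero; suc; toℕ; fromℕ<)
open import Data.Fin.Properties as Fin
  using (pigeonhole; toℕ<n; toℕ-fromℕ<; *↔×; +↔⊎; 1↔⊤; ∀-cons-⇔)
open import Data.Fin.Subset using (Subset)
open import Data.Fin.Subset.Properties using (anySubset?)
open import Data.List.Base as List
  using (List; []; _∷_; [_]; _++_; concatMap; map; foldl; foldr; length; take; drop)
open import Data.List.Membership.Propositional using (_∈_)
open import Data.List.Properties
  using (foldl-++; ∷-injective; ∷-injectiveˡ; ∷-injectiveʳ; ++-identityʳ; ++-assoc;
         ++-cancelˡ; length-++; length-take; length-drop; length-replicate; take++drop≡id;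
         concatMap-++; map-++; map-replicate)
open import Data.List.Relation.Unary.Any using (here; there)
open import Data.Nat.Base hiding (parity)
open import Data.Nat.DivMod
  using (_/_; _%_; m≡m%n+[m/n]*n; [m+kn]%n≡m%n; m<n⇒m%n≡m; /-monoˡ-≤; m*n/n≡m)
open import Data.Nat.Induction using (<-wellFounded)
open import Data.Nat.Properties as ℕ hiding (_≟_)
open import Data.Nat.Tactic.RingSolver using (solve-∀)
open import Data.Product.Base using (∃; _×_; _,_)
open import Data.Product.Function.NonDependent.Propositional using (_×-⇔_; _×-↔_)
open import Data.Sum.Base using (_⊎_; inj₁; inj₂; [_,_]′; map₁)
open import Data.Sum.Function.Propositional using (_⊎-⇔_; _⊎-↔_)
open import Data.Sum.Properties using (inj₂-injective)
open import Data.Unit.Base using (⊤; tt)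
open import Data.Vec.Base as Vec using (Vec; []; _∷_; lookup; tabulate)
open import Data.Vec.Properties
  using (lookup-zipWith; tabulate-cong; tabulate∘lookup; lookup∘tabulate)
open import Function.Base using (_∘_; id; const)
open import Function.Bundles using (_⇔_; mk⇔; _↔_; Equivalence; Inverse; Injection)
open import Function.Construct.Composition using (_⇔-∘_; _↔-∘_)
open import Function.Construct.Identity using (⇔-id)
open import Function.Construct.Symmetry using (↔-sym)
open import Function.Properties.Inverse using (↔⇒↣)
open import Induction.WellFounded using (Acc; acc)
open import Relation.Binary.Definitions using (DecidableEquality)
open import Relation.Binary.PropositionalEquality hiding ([_])
open import Relation.Nullary.Decidable as Dec
  using (Dec; yes; no; ¬?; _×-dec_; _⊎-dec_; via-injection)
open import Relation.Nullary.Negation using (contradiction; ¬_)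

open import Algebra.Properties.Semiring.Sum +-*-semiring
  using (sum; sum-cong-≗; sum-replicate-zero; ∑-distrib-+; *-distribˡ-sum)

open Equivalence using (to; from)

≡-cong-⇔ : ∀ {B : Set} {x x′ y y′ : B} → x ≡ x′ → y ≡ y′ → (x ≡ y) ⇔ (x′ ≡ y′)
≡-cong-⇔ refl refl = ⇔-id _

-- Binary expansions of tuples of natural numbers

bit : Bool → ℕ
bit false = 0
bit true  = 1

zeros : ∀ {n} → Vec ℕ n
zeros = Vec.replicate _ 0

infixr 5 _◂_

_◂_ : ∀ {n} → Subset n → Vec ℕ n → Vec ℕ n
_◂_ = Vec.zipWith (λ d v → bit d + 2 * v)

value : ∀ {n} → List (Subset n) → Vec ℕ n
value = foldr _◂_ zeros

-- The bound acts as fuel: halving lowers it by at least one, which makes the recursion in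
-- `value-surjective` structural.
halve : ∀ f v → v ≤ suc f → ∃ λ d → ∃ λ u → u ≤ f × v ≡ bit d + 2 * u
halve f       zero          _         = false , 0 , z≤n , refl
halve f       (suc zero)    _         = true , 0 , z≤n , refl
halve (suc f) (suc (suc v)) (s≤s v<f) with halve f v (≤-trans (n≤1+n v) v<f)
... | d , u , u≤f , refl = d , suc u , s≤s u≤f , shift (bit d) u
  where
  shift : ∀ x y → suc (suc (x + 2 * y)) ≡ x + 2 * suc y
  shift = solve-∀
halve zero (suc (suc v)) (s≤s ())

halves : ∀ {n} f (ν : Vec ℕ n) → (∀ i → lookup ν i ≤ suc f) →
         ∃ λ b → ∃ λ μ → (∀ i → lookup μ i ≤ f) × ν ≡ b ◂ μ
halves f []      ν≤f = [] , [] , (λ ()) , refl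
halves f (v ∷ ν) ν≤f
  with d , u , u≤f , refl ← halve f v (ν≤f zero)
     | b , μ , μ≤f , refl ← halves f ν (ν≤f ∘ suc)
  = d ∷ b , u ∷ μ , (λ { zero → u≤f ; (suc i) → μ≤f i }) , refl

≤0⇒zeros : ∀ {n} (ν : Vec ℕ n) → (∀ i → lookup ν i ≤ 0) → ν ≡ zeros
≤0⇒zeros []      ν≤0 = refl
≤0⇒zeros (v ∷ ν) ν≤0 = cong₂ _∷_ (n≤0⇒n≡0 (ν≤0 zero)) (≤0⇒zeros ν (ν≤0 ∘ suc))

lookup≤sum : ∀ {n} (ν : Vec ℕ n) i → lookup ν i ≤ Vec.sum ν
lookup≤sum (v ∷ ν) zero    = m≤m+n v _
lookup≤sum (v ∷ ν) (suc i) = ≤-trans (lookup≤sum ν i) (m≤n+m _ v)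

value-surjective : ∀ {n} (ν : Vec ℕ n) → ∃ λ w → value w ≡ ν
-- The sum of the components is a common bound for all of them, hence enough fuel.
value-surjective ν = go (Vec.sum ν) ν (lookup≤sum ν)
  where
  go : ∀ {n} f (ν : Vec ℕ n) → (∀ i → lookup ν i ≤ f) → ∃ λ w → value w ≡ ν
  go zero    ν ν≤0 = [] , sym (≤0⇒zeros ν ν≤0)
  go (suc f) ν ν≤f
    with b , μ , μ≤f , refl ← halves f ν ν≤f
    with w , refl ← go f μ μ≤f
    = b ∷ w , refl

-- Finite automata on binary digits and their emptiness problem

-- A finite automaton reading tuples of numbers in binary, least significant
-- digit first; a state is specified by the set of tuples it accepts.
record Recognizable {n} (P : Vec ℕ n → Set) : Set₁ where
  field
    State         : Set
    {size}        : ℕ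
    finite        : State ↔ Fin size
    Accepts       : State → Vec ℕ n → Set
    start         : State
    next          : State → Subset n → State
    start-correct : ∀ ν → Accepts start ν ⇔ P ν
    next-correct  : ∀ s b ν → Accepts s (b ◂ ν) ⇔ Accepts (next s b) ν
    zeros?        : ∀ s → Dec (Accepts s zeros)

module _ {n} {P : Vec ℕ n → Set} (R : Recognizable P) where
  open Recognizable R

  private
    AcceptsWord : State → List (Subset n) → Set
    AcceptsWord s w = Accepts (foldl next s w) zeros

    accepts⇔ : ∀ s w → Accepts s (value w) ⇔ AcceptsWord s w
    accepts⇔ s []      = ⇔-id _
    accepts⇔ s (b ∷ w) = accepts⇔ (next s b) w ⇔-∘ next-correct s b (value w)

    -- Exhaustive search: there are finitely many digit tuples to read first, and each reading uses
    -- up one unit of `f`.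
    short? : ∀ f s → Dec (∃ λ w → length w ≤ f × AcceptsWord s w)
    short? f s with zeros? s
    ... | yes p = yes ([] , z≤n , p)
    short? zero s | no ¬p = no λ { ([] , _ , p) → ¬p p }
    short? (suc f) s | no ¬p =
      Dec.map′ (λ { (b , w , w≤f , p) → b ∷ w , s≤s w≤f , p })
               (λ { ([] , _ , p) → contradiction p ¬p
                  ; (b ∷ w , s≤s w≤f , p) → b , w , w≤f , p })
               (anySubset? (λ b → short? f (next s b)))

    -- Pumping: the proper prefixes of `w` outnumber the states, so two of them lead to the same
    -- state. Cutting out the factor between them does not change the final state.
    cut-loop : ∀ s w → size < length w → AcceptsWord s w →
               ∃ λ w′ → length w′ < length w × AcceptsWord s w′
    cut-loop s w size<w p
      with i , j , i<j , same ← pigeonhole size<w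
             (λ i → Inverse.to finite (foldl next s (take (toℕ i) w)))
      = take (toℕ i) w ++ drop (toℕ j) w , shorter , subst (λ t → Accepts t zeros) run p
      where
      same-state : foldl next s (take (toℕ i) w) ≡ foldl next s (take (toℕ j) w)
      same-state = Injection.injective (↔⇒↣ finite) same

      run : foldl next s w ≡ foldl next s (take (toℕ i) w ++ drop (toℕ j) w)
      run = begin
        foldl next s w
          ≡⟨ cong (foldl next s) (take++drop≡id (toℕ j) w) ⟨
        foldl next s (take (toℕ j) w ++ drop (toℕ j) w)
          ≡⟨ foldl-++ next s (take (toℕ j) w) _ ⟩
        foldl next (foldl next s (take (toℕ j) w)) (drop (toℕ j) w)
          ≡⟨ cong (λ t → foldl next t (drop (toℕ j) w)) same-state ⟨
        foldl next (foldl next s (take (toℕ i) w)) (drop (toℕ j) w)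
          ≡⟨ foldl-++ next s (take (toℕ i) w) _ ⟨
        foldl next s (take (toℕ i) w ++ drop (toℕ j) w) ∎
        where open ≡-Reasoning

      shorter : length (take (toℕ i) w ++ drop (toℕ j) w) < length w
      shorter = begin-strict
        length (take (toℕ i) w ++ drop (toℕ j) w)
          ≡⟨ length-++ (take (toℕ i) w) ⟩
        length (take (toℕ i) w) + length (drop (toℕ j) w)
          ≡⟨ cong₂ _+_ (length-take (toℕ i) w) (length-drop (toℕ j) w) ⟩
        (toℕ i ⊓ length w) + (length w ∸ toℕ j)
          ≤⟨ +-monoˡ-≤ _ (m⊓n≤m (toℕ i) _) ⟩
        toℕ i + (length w ∸ toℕ j)
          <⟨ +-monoˡ-< _ i<j ⟩
        toℕ j + (length w ∸ toℕ j)
          ≡⟨ m+[n∸m]≡n (<⇒≤ (toℕ<n j)) ⟩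
        length w ∎
        where open ≤-Reasoning

    shorten : ∀ s w → Acc _<_ (length w) → AcceptsWord s w →
              ∃ λ w′ → length w′ ≤ size × AcceptsWord s w′
    shorten s w (acc rec) p with length w ≤? size
    ... | yes w≤size = w , w≤size , p
    ... | no  w≰size
      with w′ , w′<w , p′ ← cut-loop s w (≰⇒> w≰size) p
      = shorten s w′ (rec w′<w) p′

  -- Every tuple is the value of some digit word, so a solution gives an accepted word. Pumping
  -- shortens it to at most `size` digits, and the words of that length can be searched.
  satisfiable? : Dec (∃ P)
  satisfiable? = Dec.map′
    (λ { (w , _ , p) → value w , to (start-correct _) (from (accepts⇔ start w) p) })
    (λ { (ν , p) → short ν p })
    (short? size start)
    where
    short : ∀ ν → P ν → ∃ λ w → length w ≤ size × AcceptsWord start w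
    short ν p with w , refl ← value-surjective ν =
      shorten start w (<-wellFounded _) (to (accepts⇔ start w) (from (start-correct _) p))

-- Closure of recognizable predicates under positive connectives

module _ {n} {P Q : Vec ℕ n → Set} where
  open Recognizable

  recognizable-cong : (∀ ν → P ν ⇔ Q ν) → Recognizable P → Recognizable Q
  recognizable-cong P⇔Q R = record
    { Recognizable R
    ; start-correct = λ ν → P⇔Q ν ⇔-∘ start-correct R ν
    }

  private
    module Product (R : Recognizable P) (R′ : Recognizable Q) where
      states : (State R × State R′) ↔ Fin (size R * size R′)
      states = ↔-sym *↔× ↔-∘ (finite R ×-↔ finite R′)

  recognizable-× : Recognizable P → Recognizable Q → Recognizable (λ ν → P ν × Q ν)
  recognizable-× R R′ = record
    { finite        = Product.states R R′
    ; Accepts       = λ (s , t) ν → Accepts R s ν × Accepts R′ t ν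
    ; start         = start R , start R′
    ; next          = λ (s , t) b → next R s b , next R′ t b
    ; start-correct = λ ν → start-correct R ν ×-⇔ start-correct R′ ν
    ; next-correct  = λ (s , t) b ν → next-correct R s b ν ×-⇔ next-correct R′ t b ν
    ; zeros?        = λ (s , t) → zeros? R s ×-dec zeros? R′ t
    }

  -- The automata are deterministic, so the product that serves for conjunction serves for
  -- disjunction too: both components run to the end and either may accept.
  recognizable-⊎ : Recognizable P → Recognizable Q → Recognizable (λ ν → P ν ⊎ Q ν)
  recognizable-⊎ R R′ = record
    { finite        = Product.states R R′
    ; Accepts       = λ (s , t) ν → Accepts R s ν ⊎ Accepts R′ t ν
    ; start         = start R , start R′
    ; next          = λ (s , t) b → next R s b , next R′ t b
    ; start-correct = λ ν → start-correct R ν ⊎-⇔ start-correct R′ ν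
    ; next-correct  = λ (s , t) b ν → next-correct R s b ν ⊎-⇔ next-correct R′ t b ν
    ; zeros?        = λ (s , t) → zeros? R s ⊎-dec zeros? R′ t
    }

module _ {n : ℕ} where
  recognizable-const : ∀ {D : Set} → Dec D → Recognizable {n} (λ _ → D)
  recognizable-const {D} D? = record
    { finite        = ↔-sym 1↔⊤
    ; Accepts       = λ _ _ → D
    ; start         = tt
    ; next          = λ _ _ → tt
    ; start-correct = λ _ → ⇔-id _
    ; next-correct  = λ _ _ _ → ⇔-id _
    ; zeros?        = λ _ → D?
    }

  recognizable-∀ : ∀ {m} {P : Fin m → Vec ℕ n → Set} →
                   (∀ i → Recognizable (P i)) → Recognizable (λ ν → ∀ i → P i ν)
  recognizable-∀ {zero}  R =
    recognizable-cong (λ _ → mk⇔ (λ _ ()) (λ _ → tt)) (recognizable-const (yes tt))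
  recognizable-∀ {suc m} R =
    recognizable-cong (λ _ → ∀-cons-⇔) (recognizable-× (R zero) (recognizable-∀ (R ∘ suc)))

  -- Affine functions and the carry automaton for linear equations

  -- In place of coefficients, the record keeps what a digit-by-digit reading uses: the contribution
  -- `low b` of the lowest digits, with a uniform bound on it, and the doubling of the rest.
  record Affine (f : Vec ℕ n → ℕ) : Set where
    field
      constant   : ℕ
      linear     : Vec ℕ n → ℕ
      low        : Subset n → ℕ
      bound      : ℕ
      split      : ∀ ν → f ν ≡ constant + linear ν
      linear-◂   : ∀ b ν → linear (b ◂ ν) ≡ low b + 2 * linear ν
      low≤bound  : ∀ b → low b ≤ bound

  open Affine

  affine-cong : ∀ {f g} → (∀ ν → f ν ≡ g ν) → Affine f → Affine g
  affine-cong f≡g F = record { Affine F ; split = λ ν → trans (sym (f≡g ν)) (split F ν) }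

  affine-const : ∀ c → Affine (λ _ → c)
  affine-const c = record
    { constant  = c
    ; linear    = λ _ → 0
    ; low       = λ _ → 0
    ; bound     = 0
    ; split     = λ _ → sym (+-identityʳ c)
    ; linear-◂  = λ _ _ → refl
    ; low≤bound = λ _ → z≤n
    }

  affine-lookup : ∀ i → Affine (λ ν → lookup ν i)
  affine-lookup i = record
    { constant  = 0
    ; linear    = λ ν → lookup ν i
    ; low       = λ b → bit (lookup b i)
    ; bound     = 1
    ; split     = λ _ → refl
    ; linear-◂  = lookup-zipWith _ i
    ; low≤bound = λ b → bit≤1 (lookup b i)
    }
    where
    bit≤1 : ∀ d → bit d ≤ 1
    bit≤1 false = z≤n
    bit≤1 true  = s≤s z≤n

  affine-+ : ∀ {f g} → Affine f → Affine g → Affine (λ ν → f ν + g ν)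
  affine-+ F G = record
    { constant  = constant F + constant G
    ; linear    = λ ν → linear F ν + linear G ν
    ; low       = λ b → low F b + low G b
    ; bound     = bound F + bound G
    ; split     = λ ν → trans (cong₂ _+_ (split F ν) (split G ν)) (interchange (constant F) _ _ _)
    ; linear-◂  = λ b ν → trans (cong₂ _+_ (linear-◂ F b ν) (linear-◂ G b ν))
                                (interchange₂ (low F b) (linear F ν) (low G b) (linear G ν))
    ; low≤bound = λ b → +-mono-≤ (low≤bound F b) (low≤bound G b)
    }
    where
    interchange : ∀ p x q y → (p + x) + (q + y) ≡ (p + q) + (x + y)
    interchange = solve-∀
    interchange₂ : ∀ p x q y → (p + 2 * x) + (q + 2 * y) ≡ (p + q) + 2 * (x + y)
    interchange₂ = solve-∀

  module _ {f g : Vec ℕ n → ℕ} (F : Affine f) (G : Affine g) where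
    private
      -- `B` bounds the initial carries and all digit contributions. As `(B + B) / 2` is `B` again,
      -- no later carry exceeds it and finitely many states suffice.
      B = (constant F ⊔ constant G) ⊔ (bound F ⊔ bound G)

      constF≤B : constant F ≤ B
      constF≤B = m≤n⇒m≤n⊔o _ (m≤m⊔n _ _)
      constG≤B : constant G ≤ B
      constG≤B = m≤n⇒m≤n⊔o _ (m≤n⊔m (constant F) _)
      boundF≤B : bound F ≤ B
      boundF≤B = m≤n⇒m≤o⊔n (constant F ⊔ constant G) (m≤m⊔n _ _)
      boundG≤B : bound G ≤ B
      boundG≤B = m≤n⇒m≤o⊔n (constant F ⊔ constant G) (m≤n⊔m (bound F) _)

      -- The carries of both sides, or a dead state once the parities disagree.
      Carries = ⊤ ⊎ (Fin (suc B) × Fin (suc B))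

      carry : ∀ p → p ≤ B → Fin (suc B)
      carry p p≤B = fromℕ< (s≤s p≤B)

      carry-+ : ∀ p (p≤B : p ≤ B) x → toℕ (carry p p≤B) + x ≡ p + x
      carry-+ p p≤B x = cong (_+ x) (toℕ-fromℕ< (s≤s p≤B))

      advance : ∀ {x} (c : Fin (suc B)) → x ≤ B → (toℕ c + x) / 2 ≤ B
      advance {x} c x≤B = begin
        (toℕ c + x) / 2 ≤⟨ /-monoˡ-≤ 2 (+-mono-≤ (s≤s⁻¹ (toℕ<n c)) x≤B) ⟩
        (B + B) / 2     ≡⟨ cong (_/ 2) (double B) ⟩
        B * 2 / 2       ≡⟨ m*n/n≡m B 2 ⟩
        B               ∎
        where
        open ≤-Reasoning
        double : ∀ x → x + x ≡ x * 2
        double = solve-∀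

      advanceF : ∀ c b → (toℕ c + low F b) / 2 ≤ B
      advanceF c b = advance c (≤-trans (low≤bound F b) boundF≤B)

      advanceG : ∀ c b → (toℕ c + low G b) / 2 ≤ B
      advanceG c b = advance c (≤-trans (low≤bound G b) boundG≤B)

      accepts : Carries → Vec ℕ n → Set
      accepts (inj₁ _)       ν = ⊥
      accepts (inj₂ (p , q)) ν = toℕ p + linear F ν ≡ toℕ q + linear G ν

      step : Carries → Subset n → Carries
      step (inj₁ _)       b = inj₁ tt
      step (inj₂ (p , q)) b with (toℕ p + low F b) % 2 ℕ.≟ (toℕ q + low G b) % 2
      ... | yes _ = inj₂ ( carry _ (advanceF p b)
                         , carry _ (advanceG q b))
      ... | no  _ = inj₁ tt

      parity : ∀ p u → (p + 2 * u) % 2 ≡ p % 2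
      parity p u = trans (cong (λ z → (p + z) % 2) (*-comm 2 u)) ([m+kn]%n≡m%n p u 2)

      digit-carry : ∀ p u → p + 2 * u ≡ p % 2 + 2 * (p / 2 + u)
      digit-carry p u = trans (cong (_+ 2 * u) (m≡m%n+[m/n]*n p 2)) (shuffle (p % 2) (p / 2) u)
        where
        shuffle : ∀ r h u → (r + h * 2) + 2 * u ≡ r + 2 * (h + u)
        shuffle = solve-∀

      -- The common remainder modulo 2 cancels, after which both sides can be halved.
      carry⇔ : ∀ p q u v → p % 2 ≡ q % 2 →
               (p + 2 * u ≡ q + 2 * v) ⇔ (p / 2 + u ≡ q / 2 + v)
      carry⇔ p q u v r≡ = mk⇔
        (λ eq → *-cancelˡ-≡ _ _ 2 (+-cancelˡ-≡ (p % 2) _ _ (begin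
          p % 2 + 2 * (p / 2 + u) ≡⟨ digit-carry p u ⟨
          p + 2 * u               ≡⟨ eq ⟩
          q + 2 * v               ≡⟨ digit-carry q v ⟩
          q % 2 + 2 * (q / 2 + v) ≡⟨ cong (_+ 2 * (q / 2 + v)) r≡ ⟨
          p % 2 + 2 * (q / 2 + v) ∎)))
        (λ eq → begin
          p + 2 * u               ≡⟨ digit-carry p u ⟩
          p % 2 + 2 * (p / 2 + u) ≡⟨ cong₂ (λ r x → r + 2 * x) r≡ eq ⟩
          q % 2 + 2 * (q / 2 + v) ≡⟨ digit-carry q v ⟨
          q + 2 * v               ∎)
        where open ≡-Reasoning

      side : ∀ {h} (H : Affine h) (c : Fin (suc B)) b ν →
             toℕ c + linear H (b ◂ ν) ≡ (toℕ c + low H b) + 2 * linear H ν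
      side H c b ν = trans (cong (toℕ c +_) (linear-◂ H b ν)) (sym (+-assoc (toℕ c) _ _))

      step-correct : ∀ s b ν → accepts s (b ◂ ν) ⇔ accepts (step s b) ν
      step-correct (inj₁ _)       b ν = ⇔-id _
      step-correct (inj₂ (p , q)) b ν
        with (toℕ p + low F b) % 2 ℕ.≟ (toℕ q + low G b) % 2
      ... | yes r≡ =
        ≡-cong-⇔ (sym (carry-+ ((toℕ p + low F b) / 2) (advanceF p b) (linear F ν)))
                 (sym (carry-+ ((toℕ q + low G b) / 2) (advanceG q b) (linear G ν)))
          ⇔-∘ (carry⇔ (toℕ p + low F b) (toℕ q + low G b) (linear F ν) (linear G ν) r≡
          ⇔-∘ ≡-cong-⇔ (side F p b ν) (side G q b ν))
      -- The unread digits enter with a factor 2, so unequal parities now rule out equality whatever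
      -- follows.
      ... | no r≢ = mk⇔ (λ eq → r≢ (begin
          (toℕ p + low F b) % 2                    ≡⟨ parity (toℕ p + low F b) (linear F ν) ⟨
          (toℕ p + low F b + 2 * linear F ν) % 2   ≡⟨ cong (_% 2) (side F p b ν) ⟨
          (toℕ p + linear F (b ◂ ν)) % 2           ≡⟨ cong (_% 2) eq ⟩
          (toℕ q + linear G (b ◂ ν)) % 2           ≡⟨ cong (_% 2) (side G q b ν) ⟩
          (toℕ q + low G b + 2 * linear G ν) % 2   ≡⟨ parity (toℕ q + low G b) (linear G ν) ⟩
          (toℕ q + low G b) % 2                    ∎))
        (λ ())
        where open ≡-Reasoning

      zeros-accepted? : ∀ s → Dec (accepts s zeros)
      zeros-accepted? (inj₁ _)       = no λ ()
      zeros-accepted? (inj₂ (p , q)) = _ ℕ.≟ _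

    recognizable-≡ : Recognizable (λ ν → f ν ≡ g ν)
    recognizable-≡ = record
      { finite        = ↔-sym +↔⊎ ↔-∘ (↔-sym 1↔⊤ ⊎-↔ ↔-sym *↔×)
      ; Accepts       = accepts
      ; start         = inj₂ (carry _ constF≤B , carry _ constG≤B)
      ; next          = step
      ; start-correct = λ ν → ≡-cong-⇔
          (trans (carry-+ (constant F) constF≤B (linear F ν)) (sym (split F ν)))
          (trans (carry-+ (constant G) constG≤B (linear G ν)) (sym (split G ν)))
      ; next-correct  = step-correct
      ; zeros?        = zeros-accepted?
      }

-- Runs of a letter and digits in base `K`

module _ {B : Set} {s : B} where
  -- The first letter other than `s` marks the end of the run, so a word determines its leading run
  -- and what comes after.
  replicate-∷-injective : ∀ {c d : B} {u v} p q → c ≢ s → d ≢ s →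
    List.replicate p s ++ c ∷ u ≡ List.replicate q s ++ d ∷ v → p ≡ q × c ≡ d × u ≡ v
  replicate-∷-injective zero    zero    c≢s d≢s eq = refl , ∷-injective eq
  replicate-∷-injective zero    (suc q) c≢s d≢s eq = contradiction (∷-injectiveˡ eq) c≢s
  replicate-∷-injective (suc p) zero    c≢s d≢s eq = contradiction (sym (∷-injectiveˡ eq)) d≢s
  replicate-∷-injective (suc p) (suc q) c≢s d≢s eq
    with p≡q , c≡d , u≡v ← replicate-∷-injective p q c≢s d≢s (∷-injectiveʳ eq)
    = cong suc p≡q , c≡d , u≡v

  -- Only the right word contains a letter other than `s`. The trailing `[]` is the image of an
  -- exhausted pattern in the uses below.
  replicate-≢-∷ : ∀ {d : B} {v} p q → d ≢ s →
    List.replicate p s ++ [] ≢ List.replicate q s ++ d ∷ v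
  replicate-≢-∷ zero    zero    d≢s ()
  replicate-≢-∷ zero    (suc q) d≢s ()
  replicate-≢-∷ (suc p) zero    d≢s eq = d≢s (sym (∷-injectiveˡ eq))
  replicate-≢-∷ (suc p) (suc q) d≢s eq = replicate-≢-∷ p q d≢s (∷-injectiveʳ eq)

  replicate-absorb : ∀ p q (u : List B) →
    List.replicate (p + q) s ++ u ≡ List.replicate p s ++ (List.replicate q s ++ u)
  replicate-absorb zero    q u = refl
  replicate-absorb (suc p) q u = cong (s ∷_) (replicate-absorb p q u)

  replicate-∷ : ∀ p (u : List B) →
    List.replicate p s ++ s ∷ u ≡ List.replicate (suc p) s ++ u
  replicate-∷ zero    u = refl
  replicate-∷ (suc p) u = cong (s ∷_) (replicate-∷ p u)

-- Reduction modulo `K` isolates the lowest digit; cancelling it and dividing by `K` leaves the same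
-- problem for the others.
digits-unique : ∀ {m} K .{{_ : NonZero K}} (f g : Fin m → ℕ) →
  (∀ i → f i < K) → (∀ i → g i < K) →
  sum (λ i → f i * K ^ toℕ i) ≡ sum (λ i → g i * K ^ toℕ i) → ∀ i → f i ≡ g i
digits-unique {suc m} K f g f<K g<K eq = λ
  { zero    → f₀≡g₀
  ; (suc i) → digits-unique K (f ∘ suc) (g ∘ suc) (f<K ∘ suc) (g<K ∘ suc)
      (*-cancelʳ-≡ _ _ K (+-cancelˡ-≡ (f zero) _ _ (trans split-eq (cong (_+ rest g * K) (sym f₀≡g₀))))) i
  }
  where
  rest : (Fin (suc m) → ℕ) → ℕ
  rest h = sum (λ i → h (suc i) * K ^ toℕ i)

  split : ∀ h → sum (λ i → h i * K ^ toℕ i) ≡ h zero + rest h * K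
  split h = cong₂ _+_ (*-identityʳ (h zero)) (begin
    sum (λ i → h (suc i) * (K * K ^ toℕ i))
      ≡⟨ sum-cong-≗ (λ i → trans (sym (*-assoc (h (suc i)) K _))
           (trans (cong (_* K ^ toℕ i) (*-comm (h (suc i)) K)) (*-assoc K (h (suc i)) _))) ⟩
    sum (λ i → K * (h (suc i) * K ^ toℕ i))
      ≡⟨ *-distribˡ-sum K (λ i → h (suc i) * K ^ toℕ i) ⟨
    K * rest h ≡⟨ *-comm K (rest h) ⟩
    rest h * K ∎)
    where open ≡-Reasoning

  split-eq : f zero + rest f * K ≡ g zero + rest g * K
  split-eq = trans (sym (split f)) (trans eq (split g))

  f₀≡g₀ : f zero ≡ g zero
  f₀≡g₀ = begin
    f zero                      ≡⟨ m<n⇒m%n≡m (f<K zero) ⟨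
    f zero % K                  ≡⟨ [m+kn]%n≡m%n (f zero) (rest f) K ⟨
    (f zero + rest f * K) % K   ≡⟨ cong (_% K) split-eq ⟩
    (g zero + rest g * K) % K   ≡⟨ [m+kn]%n≡m%n (g zero) (rest g) K ⟩
    g zero % K                  ≡⟨ m<n⇒m%n≡m (g<K zero) ⟩
    g zero                      ∎
    where open ≡-Reasoning

-- Letter counts and lengths of patterns

-- The Kronecker delta, which is the count vector of a single letter.
unit : ∀ {m} → Fin m → Fin m → ℕ
unit zero    zero    = 1
unit zero    (suc j) = 0
unit (suc i) zero    = 0
unit (suc i) (suc j) = unit i j

unit-refl : ∀ {m} (i : Fin m) → unit i i ≡ 1
unit-refl zero    = refl
unit-refl (suc i) = unit-refl i

unit≡1⇒≡ : ∀ {m} (i j : Fin m) → unit i j ≡ 1 → i ≡ j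
unit≡1⇒≡ zero    zero    _  = refl
unit≡1⇒≡ (suc i) (suc j) eq = cong suc (unit≡1⇒≡ i j eq)

unit≤1 : ∀ {m} (i j : Fin m) → unit i j ≤ 1
unit≤1 zero    zero    = ≤-refl
unit≤1 zero    (suc j) = z≤n
unit≤1 (suc i) zero    = z≤n
unit≤1 (suc i) (suc j) = unit≤1 i j

sum-unit : ∀ {m} (i : Fin m) (L : Fin m → ℕ) → sum (λ j → unit i j * L j) ≡ L i
sum-unit {suc m} zero    L = trans (cong₂ _+_ (+-identityʳ (L zero)) (sum-replicate-zero m)) (+-identityʳ _)
sum-unit {suc m} (suc i) L = sum-unit i (L ∘ suc)

module _ {A : Set} {m : ℕ} where
  slot : A ⊎ Fin m → Fin (suc m)
  slot (inj₁ _) = zero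
  slot (inj₂ j) = suc j

  -- The number of terminals at index 0, and of occurrences of variable j at index j + 1.
  count : Pattern A (Fin m) → Fin (suc m) → ℕ
  count []      i = 0
  count (s ∷ P) i = unit (slot s) i + count P i

  infix 4 _≈_

  -- Equality of Parikh vectors, with all terminals taken for one letter.
  _≈_ : Pattern A (Fin m) → Pattern A (Fin m) → Set
  P ≈ Q = ∀ i → count P i ≡ count Q i

  count-++ : ∀ P Q i → count (P ++ Q) i ≡ count P i + count Q i
  count-++ []      Q i = refl
  count-++ (s ∷ P) Q i = trans (cong (unit (slot s) i +_) (count-++ P Q i)) (sym (+-assoc (unit (slot s) i) _ _))

  count≤length : ∀ P i → count P i ≤ length P
  count≤length []      i = z≤n
  count≤length (s ∷ P) i = +-mono-≤ (unit≤1 (slot s) i) (count≤length P i)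

  letterLength : Assignment A (Fin m) → Fin (suc m) → ℕ
  letterLength y zero    = 1
  letterLength y (suc j) = length (y j)

  length-extend : ∀ y P → length (extend y P) ≡ sum (λ i → count P i * letterLength y i)
  length-extend y []      = sym (sum-replicate-zero (suc m))
  length-extend y (s ∷ P) = begin
    length ([ [_] , y ]′ s ++ extend y P)
      ≡⟨ length-++ ([ [_] , y ]′ s) ⟩
    length ([ [_] , y ]′ s) + length (extend y P)
      ≡⟨ cong₂ _+_ (length-letter s) (length-extend y P) ⟩
    L (slot s) + sum (λ i → count P i * L i)
      ≡⟨ cong (_+ sum (λ i → count P i * L i)) (sum-unit (slot s) L) ⟨
    sum (λ i → unit (slot s) i * L i) + sum (λ i → count P i * L i)
      ≡⟨ ∑-distrib-+ (λ i → unit (slot s) i * L i) (λ i → count P i * L i) ⟨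
    sum (λ i → unit (slot s) i * L i + count P i * L i)
      ≡⟨ sum-cong-≗ (λ i → *-distribʳ-+ (L i) (unit (slot s) i) (count P i)) ⟨
    sum (λ i → count (s ∷ P) i * L i) ∎
    where
    open ≡-Reasoning
    L = letterLength y
    length-letter : ∀ s → length ([ [_] , y ]′ s) ≡ L (slot s)
    length-letter (inj₁ _) = refl
    length-letter (inj₂ _) = refl

  ≈⇒length-extend-≡ : ∀ y P Q → P ≈ Q → length (extend y P) ≡ length (extend y Q)
  ≈⇒length-extend-≡ y P Q P≈Q = begin
    length (extend y P)                      ≡⟨ length-extend y P ⟩
    sum (λ i → count P i * letterLength y i) ≡⟨ sum-cong-≗ (λ i → cong (_* letterLength y i) (P≈Q i)) ⟩
    sum (λ i → count Q i * letterLength y i) ≡⟨ length-extend y Q ⟨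
    length (extend y Q)                      ∎
    where open ≡-Reasoning

-- Generic words for the universal variables

module Generic {A : Set} (a b : A) (κ : ℕ) {m : ℕ} where
  private
    K = suc κ

    run : Fin m → ℕ
    run j = K ^ suc (toℕ j) ∸ 1

  -- With the closing `b` the length is exactly `K ^ suc (toℕ j)`. A terminal has length `K ^ 0`, so
  -- the letters of a pattern have the place values of base `K` as lengths.
  generic : Assignment A (Fin m)
  generic j = List.replicate (run j) a ++ [ b ]

  private
    suc-run : ∀ j → suc (run j) ≡ K ^ suc (toℕ j)
    suc-run j = m+[n∸m]≡n (m^n>0 K (suc (toℕ j)))

    κ≤run : ∀ j → κ ≤ run j
    κ≤run j = s≤s⁻¹ (≤-trans (m≤m*n K (K ^ toℕ j) {{m^n≢0 K (toℕ j)}}) (≤-reflexive (sym (suc-run j))))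

    length-generic : ∀ j → length (generic j) ≡ suc (run j)
    length-generic j = begin
      length (List.replicate (run j) a ++ [ b ])     ≡⟨ length-++ (List.replicate (run j) a) ⟩
      length (List.replicate (run j) a) + 1          ≡⟨ cong (_+ 1) (length-replicate (run j)) ⟩
      run j + 1                                      ≡⟨ +-comm (run j) 1 ⟩
      suc (run j)                                    ∎
      where open ≡-Reasoning

    letterLength-generic : ∀ i → letterLength generic i ≡ K ^ toℕ i
    letterLength-generic zero    = refl
    letterLength-generic (suc j) = trans (length-generic j) (suc-run j)

  -- No count exceeds `κ`, which is less than `K`; the counts are therefore the digits of the length
  -- in base `K`.
  length-generic-injective : ∀ P Q → length P ≤ κ → length Q ≤ κ →
    length (extend generic P) ≡ length (extend generic Q) → P ≈ Q
  length-generic-injective P Q P≤κ Q≤κ eq =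
    digits-unique K (count P) (count Q)
      (λ i → s≤s (≤-trans (count≤length P i) P≤κ))
      (λ i → s≤s (≤-trans (count≤length Q i) Q≤κ))
      (trans (sym (digits P)) (trans eq (digits Q)))
    where
    digits : ∀ P → length (extend generic P) ≡ sum (λ i → count P i * K ^ toℕ i)
    digits P = trans (length-extend generic P)
                     (sum-cong-≗ (λ i → cong (count P i *_) (letterLength-generic i)))

  module _ (_≟_ : DecidableEquality A) (b≢a : b ≢ a) where
    private
      -- Up to the closing `b`, the equation compares the lengths of the images of two short
      -- patterns: variable `i` with `t` terminals, and variable `j` alone. Their counts must agree.
      run-offset : ∀ t i j → suc t ≤ κ → t + run i ≡ run j → t ≡ 0 × i ≡ j
      run-offset t i j t<κ eq = t≡0 , unit≡1⇒≡ i j (trans count-j (unit-refl j))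
        where
        P Q : Pattern A (Fin m)
        P = inj₂ i ∷ List.replicate t (inj₁ a)
        Q = inj₂ j ∷ []

        extend-replicate : ∀ t → length (extend generic (List.replicate t (inj₁ a))) ≡ t
        extend-replicate zero    = refl
        extend-replicate (suc t) = cong suc (extend-replicate t)

        length-P : length (extend generic P) ≡ suc (t + run i)
        length-P = begin
          length (generic i ++ extend generic (List.replicate t (inj₁ a)))
            ≡⟨ length-++ (generic i) ⟩
          length (generic i) + length (extend generic (List.replicate t (inj₁ a)))
            ≡⟨ cong₂ _+_ (length-generic i) (extend-replicate t) ⟩
          suc (run i + t)
            ≡⟨ cong suc (+-comm (run i) t) ⟩
          suc (t + run i) ∎
          where open ≡-Reasoning

        length-Q : length (extend generic Q) ≡ suc (run j)
        length-Q = trans (cong length (++-identityʳ (generic j))) (length-generic j)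

        P≈Q : P ≈ Q
        P≈Q = length-generic-injective P Q
          (≤-trans (s≤s (≤-reflexive (length-replicate t))) t<κ)
          (≤-trans (s≤s z≤n) t<κ)
          (trans length-P (trans (cong suc eq) (sym length-Q)))

        count-replicate : ∀ t → count (List.replicate t (inj₁ a)) zero ≡ t
        count-replicate zero    = refl
        count-replicate (suc t) = cong suc (count-replicate t)

        count-replicate-suc : ∀ t i → count (List.replicate t (inj₁ a)) (suc i) ≡ 0
        count-replicate-suc zero    i = refl
        count-replicate-suc (suc t) i = count-replicate-suc t i

        t≡0 : t ≡ 0
        t≡0 = trans (sym (count-replicate t)) (P≈Q zero)

        count-j : unit i j ≡ unit j j
        count-j = begin
          unit i j                                             ≡⟨ +-identityʳ _ ⟨
          unit i j + 0                                         ≡⟨ cong (unit i j +_) (count-replicate-suc t j) ⟨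
          unit i j + count (List.replicate t (inj₁ a)) (suc j) ≡⟨ P≈Q (suc j) ⟩
          unit j j + 0                                         ≡⟨ +-identityʳ _ ⟩
          unit j j                                             ∎
          where open ≡-Reasoning

      unfold : ∀ j R → generic j ++ R ≡ List.replicate (run j) a ++ b ∷ R
      unfold j R = ++-assoc (List.replicate (run j) a) [ b ] R

      m+1+n≤o⇒m<o : ∀ m n {o} → m + suc n ≤ o → m < o
      m+1+n≤o⇒m<o m n {o} m+1+n≤o = m+n≤o⇒m≤o (suc m) (subst (_≤ o) (+-suc m n) m+1+n≤o)

      align : ∀ t i j R R′ → List.replicate t a ++ (generic i ++ R) ≡ generic j ++ R′ →
              List.replicate (t + run i) a ++ b ∷ R ≡ List.replicate (run j) a ++ b ∷ R′
      align t i j R R′ eq = begin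
        List.replicate (t + run i) a ++ b ∷ R                    ≡⟨ replicate-absorb t (run i) _ ⟩
        List.replicate t a ++ (List.replicate (run i) a ++ b ∷ R) ≡⟨ cong (List.replicate t a ++_) (unfold i R) ⟨
        List.replicate t a ++ (generic i ++ R)                   ≡⟨ eq ⟩
        generic j ++ R′                                          ≡⟨ unfold j R′ ⟩
        List.replicate (run j) a ++ b ∷ R′                       ∎
        where open ≡-Reasoning

      -- The accumulator `t` holds the terminals `a` read so far. The pattern is too short for
      -- terminals to fill the run of `generic j`, and by `run-offset` a variable completes that run
      -- only if it is `j` itself with no terminal before it.
      starts-with : ∀ t P j R → t + length P ≤ κ →
        List.replicate t a ++ extend generic P ≡ generic j ++ R →
        t ≡ 0 × ∃ λ P′ → P ≡ inj₂ j ∷ P′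
      starts-with t [] j R t≤κ eq =
        contradiction (trans eq (unfold j R)) (replicate-≢-∷ t (run j) b≢a)
      starts-with t (inj₁ c ∷ P) j R t≤κ eq with c ≟ a
      ... | yes refl
        -- The recursive call would force `suc t ≡ 0`.
        with () , _ ← starts-with (suc t) P j R
               (subst (_≤ κ) (+-suc t (length P)) t≤κ)
               (trans (sym (replicate-∷ t _)) eq)
      -- Here `c` ends the run after `t` letters, although `t < κ ≤ run j`.
      ... | no c≢a
        with refl , _ ← replicate-∷-injective t (run j) c≢a b≢a (trans eq (unfold j R))
        = contradiction (κ≤run j)
            (<⇒≱ (m+1+n≤o⇒m<o t (length P) t≤κ))
      starts-with t (inj₂ i ∷ P) j R t≤κ eq
        with t+i≡j , _ ← replicate-∷-injective (t + run i) (run j) b≢a b≢a (align t i j _ R eq)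
        with t≡0 , refl ← run-offset t i j (m+1+n≤o⇒m<o t (length P) t≤κ) t+i≡j
        = t≡0 , P , refl

      generic-nonempty : ∀ j R → [] ≢ generic j ++ R
      generic-nonempty j R eq = replicate-≢-∷ 0 (run j) b≢a (trans eq (unfold j R))

    -- The code property, for patterns of length at most `κ`: by `starts-with`, an image beginning
    -- with `generic j` comes from a pattern beginning with variable `j`, so equal first letters can
    -- be cancelled one at a time.
    extend-generic-injective : ∀ P Q → length P ≤ κ → length Q ≤ κ →
      extend generic P ≡ extend generic Q → P ≡ Q
    extend-generic-injective []           []           P≤κ Q≤κ eq = refl
    extend-generic-injective []           (inj₂ j ∷ Q) P≤κ Q≤κ eq = contradiction eq (generic-nonempty j _)
    extend-generic-injective (inj₂ i ∷ P) []           P≤κ Q≤κ eq = contradiction (sym eq) (generic-nonempty i _)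
    extend-generic-injective (inj₁ c ∷ P) (inj₁ d ∷ Q) P≤κ Q≤κ eq
      with refl , eq′ ← ∷-injective eq
      = cong (inj₁ c ∷_) (extend-generic-injective P Q (<⇒≤ P≤κ) (<⇒≤ Q≤κ) eq′)
    extend-generic-injective (inj₂ i ∷ P) (inj₂ j ∷ Q) P≤κ Q≤κ eq
      with _ , _ , refl ← starts-with 0 (inj₂ i ∷ P) j _ P≤κ eq
      = cong (inj₂ i ∷_) (extend-generic-injective P Q (<⇒≤ P≤κ) (<⇒≤ Q≤κ) (++-cancelˡ (generic i) _ _ eq))
    extend-generic-injective (inj₁ c ∷ P) (inj₂ j ∷ Q) P≤κ Q≤κ eq
      with _ , _ , () ← starts-with 0 (inj₁ c ∷ P) j _ P≤κ eq
    extend-generic-injective (inj₂ i ∷ P) (inj₁ d ∷ Q) P≤κ Q≤κ eq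
      with _ , _ , () ← starts-with 0 (inj₁ d ∷ Q) i _ Q≤κ (sym eq)

-- Substitution for the existential variables, and skeletons

module _ {A : Set} {n m : ℕ} where
  private
    Letter = A ⊎ (Fin n ⊎ Fin m)

  letterImage : Assignment A (Fin n) → Letter → Pattern A (Fin m)
  letterImage x (inj₁ c)        = [ inj₁ c ]
  letterImage x (inj₂ (inj₁ i)) = map inj₁ (x i)
  letterImage x (inj₂ (inj₂ j)) = [ inj₂ j ]

  substitute : Assignment A (Fin n) → Pattern A (Fin n ⊎ Fin m) → Pattern A (Fin m)
  substitute x = concatMap (letterImage x)

  extend-map-inj₁ : ∀ {X : Set} (y : Assignment A X) u → extend y (map inj₁ u) ≡ u
  extend-map-inj₁ y []      = refl
  extend-map-inj₁ y (c ∷ u) = cong (c ∷_) (extend-map-inj₁ y u)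

  extend-substitute : ∀ x y U → extend [ x , y ]′ U ≡ extend y (substitute x U)
  extend-substitute x y []      = refl
  extend-substitute x y (s ∷ U) = begin
    [ [_] , [ x , y ]′ ]′ s ++ extend [ x , y ]′ U
      ≡⟨ cong₂ _++_ (sym (letter s)) (extend-substitute x y U) ⟩
    extend y (letterImage x s) ++ extend y (substitute x U)
      ≡⟨ concatMap-++ _ (letterImage x s) (substitute x U) ⟨
    extend y (substitute x (s ∷ U)) ∎
    where
    open ≡-Reasoning
    letter : ∀ s → extend y (letterImage x s) ≡ [ [_] , [ x , y ]′ ]′ s
    letter (inj₁ c)        = refl
    letter (inj₂ (inj₁ i)) = extend-map-inj₁ y (x i)
    letter (inj₂ (inj₂ j)) = ++-identityʳ (y j)

lengths : ∀ {A : Set} {n} → Assignment A (Fin n) → Vec ℕ n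
lengths x = tabulate (length ∘ x)

OnlyUses : ∀ {A X : Set} → A → Pattern A X → Set
OnlyUses a U = ∀ {c} → inj₁ c ∈ U → c ≡ a

module Skeleton {A : Set} (_≟_ : DecidableEquality A) (a : A) {n m : ℕ} where
  private
    Letter = A ⊎ (Fin n ⊎ Fin m)

  powers : Vec ℕ n → Assignment A (Fin n)
  powers ν i = List.replicate (lookup ν i) a

  lengths-powers : ∀ ν → lengths (powers ν) ≡ ν
  lengths-powers ν = trans (tabulate-cong (λ i → length-replicate (lookup ν i))) (tabulate∘lookup ν)

  letterSkeleton : Vec ℕ n → Letter → Pattern A (Fin m)
  letterSkeleton ν (inj₁ c)        = [ inj₁ a ]
  letterSkeleton ν (inj₂ (inj₁ i)) = List.replicate (lookup ν i) (inj₁ a)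
  letterSkeleton ν (inj₂ (inj₂ j)) = [ inj₂ j ]

  -- What is left of a substituted pattern when all terminals become `a`. It depends on `x` through
  -- the lengths `ν` alone.
  skeleton : Vec ℕ n → Pattern A (Fin n ⊎ Fin m) → Pattern A (Fin m)
  skeleton ν = concatMap (letterSkeleton ν)

  erase : Pattern A (Fin m) → Pattern A (Fin m)
  erase = map (map₁ (const a))

  erase-substitute : ∀ x U → erase (substitute x U) ≡ skeleton (lengths x) U
  erase-substitute x []      = refl
  erase-substitute x (s ∷ U) =
    trans (map-++ _ (letterImage x s) (substitute x U)) (cong₂ _++_ (letter s) (erase-substitute x U))
    where
    erase-word : ∀ u → erase (map inj₁ u) ≡ List.replicate (length u) (inj₁ a)
    erase-word []      = refl
    erase-word (c ∷ u) = cong (inj₁ a ∷_) (erase-word u)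

    letter : ∀ s → erase (letterImage x s) ≡ letterSkeleton (lengths x) s
    letter (inj₁ c)        = refl
    letter (inj₂ (inj₁ i)) = trans (erase-word (x i))
      (cong (λ k → List.replicate k (inj₁ a)) (sym (lookup∘tabulate (length ∘ x) i)))
    letter (inj₂ (inj₂ j)) = refl

  -- With `x` in powers of `a` and no terminal but `a` in `U`, erasure has nothing to change.
  substitute-powers : ∀ ν {U} → OnlyUses a U → substitute (powers ν) U ≡ skeleton ν U
  substitute-powers ν {[]}    only = refl
  substitute-powers ν {s ∷ U} only =
    cong₂ _++_ (letter s (λ { refl → only (here refl) })) (substitute-powers ν (λ c∈U → only (there c∈U)))
    where
    letter : ∀ s → (∀ {c} → inj₁ c ≡ s → c ≡ a) → letterImage (powers ν) s ≡ letterSkeleton ν s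
    letter (inj₁ c)        c≡a = cong (λ d → [ inj₁ d ]) (c≡a refl)
    letter (inj₂ (inj₁ i)) c≡a = map-replicate inj₁ (lookup ν i) a
    letter (inj₂ (inj₂ j)) c≡a = refl

  count-erase : ∀ P i → count (erase P) i ≡ count P i
  count-erase []           i = refl
  count-erase (inj₁ c ∷ P) i = cong (unit zero i +_) (count-erase P i)
  count-erase (inj₂ j ∷ P) i = cong (unit (suc j) i +_) (count-erase P i)

  substitute-≈ : ∀ x {ν} U → lengths x ≡ ν → substitute x U ≈ skeleton ν U
  substitute-≈ x U refl i = trans (sym (count-erase (substitute x U) i))
                                  (cong (λ P → count P i) (erase-substitute x U))

  -- An existential variable becomes a run of `a`: it contributes its length at index 0 and nothing
  -- at the indices of universal variables.
  affine-count : ∀ U i → Affine (λ ν → count (skeleton ν U) i)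
  affine-count []      i = affine-const 0
  affine-count (s ∷ U) i =
    affine-cong (λ ν → sym (count-++ (letterSkeleton ν s) (skeleton ν U) i))
      (affine-+ (letter s) (affine-count U i))
    where
    run-zero : ∀ k → k ≡ count {A} {m} (List.replicate k (inj₁ a)) zero
    run-zero zero    = refl
    run-zero (suc k) = cong suc (run-zero k)

    run-suc : ∀ k j → 0 ≡ count {A} {m} (List.replicate k (inj₁ a)) (suc j)
    run-suc zero    j = refl
    run-suc (suc k) j = run-suc k j

    affine-run : ∀ v i → Affine (λ ν → count {A} {m} (List.replicate (lookup ν v) (inj₁ a)) i)
    affine-run v zero    = affine-cong (λ ν → run-zero (lookup ν v)) (affine-lookup v)
    affine-run v (suc j) = affine-cong (λ ν → run-suc (lookup ν v) j) (affine-const 0)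

    letter : ∀ s → Affine (λ ν → count (letterSkeleton ν s) i)
    letter (inj₁ c)        = affine-const _
    letter (inj₂ (inj₁ v)) = affine-run v i
    letter (inj₂ (inj₂ j)) = affine-const _

  recognizable-≈ : ∀ U V → Recognizable (λ ν → skeleton ν U ≈ skeleton ν V)
  recognizable-≈ U V = recognizable-∀ (λ i → recognizable-≡ (affine-count U i) (affine-count V i))

  -- Recognizing the equality of two skeletons

  private
    infixr 5 _·_

    _·_ : ℕ → Pattern A (Fin m) → Pattern A (Fin m)
    p · P = List.replicate p (inj₁ a) ++ P

    inj₂≢inj₁ : ∀ {j : Fin m} → inj₂ j ≢ inj₁ a
    inj₂≢inj₁ ()

    Same : (f g : Vec ℕ n → ℕ) (U V : Pattern A (Fin n ⊎ Fin m)) → Vec ℕ n → Set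
    Same f g U V ν = f ν · skeleton ν U ≡ g ν · skeleton ν V

    never : ∀ {P : Vec ℕ n → Set} → (∀ ν → ¬ P ν) → Recognizable P
    never ¬p = recognizable-cong (λ ν → mk⇔ (λ ()) (¬p ν)) (recognizable-const (no λ ()))

    absorb : ∀ p h s U ν → letterSkeleton ν s ≡ List.replicate h (inj₁ a) →
             (p + h) · skeleton ν U ≡ p · skeleton ν (s ∷ U)
    absorb p h s U ν s≡ = trans (replicate-absorb p h _) (cong (λ P → p · (P ++ skeleton ν U)) (sym s≡))

    -- The pending a-runs f and g absorb terminals and existential variables until both
    -- sides reach a universal variable, where the runs must agree.
    recognizable-Same : ∀ {f g} → Affine f → Affine g → ∀ U V → Recognizable (Same f g U V)
    recognizable-Same {f} {g} F G (inj₁ c ∷ U) V =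
      recognizable-cong (λ ν → ≡-cong-⇔ (absorb (f ν) 1 (inj₁ c) U ν refl) refl)
        (recognizable-Same (affine-+ F (affine-const 1)) G U V)
    recognizable-Same {f} {g} F G (inj₂ (inj₁ v) ∷ U) V =
      recognizable-cong (λ ν → ≡-cong-⇔ (absorb (f ν) (lookup ν v) (inj₂ (inj₁ v)) U ν refl) refl)
        (recognizable-Same (affine-+ F (affine-lookup v)) G U V)
    recognizable-Same {f} {g} F G U (inj₁ c ∷ V) =
      recognizable-cong (λ ν → ≡-cong-⇔ refl (absorb (g ν) 1 (inj₁ c) V ν refl))
        (recognizable-Same F (affine-+ G (affine-const 1)) U V)
    recognizable-Same {f} {g} F G U (inj₂ (inj₁ v) ∷ V) =
      recognizable-cong (λ ν → ≡-cong-⇔ refl (absorb (g ν) (lookup ν v) (inj₂ (inj₁ v)) V ν refl))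
        (recognizable-Same F (affine-+ G (affine-lookup v)) U V)
    recognizable-Same {f} {g} F G [] [] =
      recognizable-cong (λ ν → mk⇔ (cong (_· [])) (runs-injective (f ν) (g ν))) (recognizable-≡ F G)
      where
      runs-injective : ∀ p q → p · [] ≡ q · [] → p ≡ q
      runs-injective p q eq = begin
        p               ≡⟨ length-run p ⟨
        length (p · []) ≡⟨ cong length eq ⟩
        length (q · []) ≡⟨ length-run q ⟩
        q               ∎
        where
        open ≡-Reasoning
        length-run : ∀ p → length (p · []) ≡ p
        length-run p = trans (cong length (++-identityʳ (List.replicate p (inj₁ a)))) (length-replicate p)
    recognizable-Same {f} {g} F G [] (inj₂ (inj₂ j) ∷ V) =
      never (λ ν → replicate-≢-∷ (f ν) (g ν) inj₂≢inj₁)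
    recognizable-Same {f} {g} F G (inj₂ (inj₂ i) ∷ U) [] =
      never (λ ν → replicate-≢-∷ (g ν) (f ν) inj₂≢inj₁ ∘ sym)
    recognizable-Same {f} {g} F G (inj₂ (inj₂ i) ∷ U) (inj₂ (inj₂ j) ∷ V) =
      recognizable-cong
        (λ ν → mk⇔
          (λ { (f≡g , refl , eq) → cong₂ (λ p P → p · inj₂ i ∷ P) f≡g eq })
          (λ eq → let f≡g , i≡j , eq′ = replicate-∷-injective (f ν) (g ν) inj₂≢inj₁ inj₂≢inj₁ eq
                  in f≡g , inj₂-injective i≡j , eq′))
        (recognizable-× (recognizable-≡ F G)
          (recognizable-× (recognizable-const (i Fin.≟ j))
            -- Behind a matched pair of universal variables both pending runs start again from zero.
            (recognizable-Same (affine-const 0) (affine-const 0) U V)))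

  recognizable-skeleton-≡ : ∀ U V → Recognizable (λ ν → skeleton ν U ≡ skeleton ν V)
  recognizable-skeleton-≡ = recognizable-Same (affine-const 0) (affine-const 0)

  -- Tests for universally valid atoms

  -- A condition on the lengths ν of x expressing that ∀ y. U ≐ V holds; `separator` is
  -- the letter b of the generic words that test it.
  record EquationTest : Set₁ where
    field
      separator    : A
      Holds        : (U V : Pattern A (Fin n ⊎ Fin m)) → Vec ℕ n → Set
      recognizable : ∀ U V → Recognizable (Holds U V)
      sound        : ∀ ν {U V} → OnlyUses a U → OnlyUses a V → Holds U V ν →
                     ∀ y → extend [ powers ν , y ]′ U ≡ extend [ powers ν , y ]′ V
      complete     : ∀ κ x U V → length (substitute x U) ≤ κ → length (substitute x V) ≤ κ →
                     let open Generic a separator κ in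
                     extend [ x , generic ]′ U ≡ extend [ x , generic ]′ V → Holds U V (lengths x)

  module _ (b : A) where
    -- The lengths of generic words are the same whichever letter closes them, so this serves both
    -- tests, including `unaryTest` with `a` as separator.
    length-complete : ∀ κ x U V → length (substitute x U) ≤ κ → length (substitute x V) ≤ κ →
      let open Generic a b κ in
      length (extend [ x , generic ]′ U) ≡ length (extend [ x , generic ]′ V) →
      skeleton (lengths x) U ≈ skeleton (lengths x) V
    length-complete κ x U V U≤κ V≤κ eq i = begin
      count (skeleton (lengths x) U) i ≡⟨ substitute-≈ x U refl i ⟨
      count (substitute x U) i         ≡⟨ length-generic-injective (substitute x U) (substitute x V) U≤κ V≤κ eq′ i ⟩
      count (substitute x V) i         ≡⟨ substitute-≈ x V refl i ⟩
      count (skeleton (lengths x) V) i ∎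
      where
      open Generic a b κ
      open ≡-Reasoning
      eq′ : length (extend generic (substitute x U)) ≡ length (extend generic (substitute x V))
      eq′ = trans (cong length (sym (extend-substitute x generic U)))
                  (trans eq (cong length (extend-substitute x generic V)))

  -- Counting does not distinguish terminals, so a substituted pattern and its skeleton have the
  -- same Parikh vector. This covers the arbitrary constant words in `Length` atoms.
  length-sound : ∀ ν U V → skeleton ν U ≈ skeleton ν V → ∀ y →
                 length (extend [ powers ν , y ]′ U) ≡ length (extend [ powers ν , y ]′ V)
  length-sound ν U V U≈V y = begin
    length (extend [ powers ν , y ]′ U)         ≡⟨ cong length (extend-substitute (powers ν) y U) ⟩
    length (extend y (substitute (powers ν) U)) ≡⟨ ≈⇒length-extend-≡ y (substitute (powers ν) U) (skeleton ν U) (substitute-≈ (powers ν) U (lengths-powers ν)) ⟩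
    length (extend y (skeleton ν U))            ≡⟨ ≈⇒length-extend-≡ y (skeleton ν U) (skeleton ν V) U≈V ⟩
    length (extend y (skeleton ν V))            ≡⟨ ≈⇒length-extend-≡ y (substitute (powers ν) V) (skeleton ν V) (substitute-≈ (powers ν) V (lengths-powers ν)) ⟨
    length (extend y (substitute (powers ν) V)) ≡⟨ cong length (extend-substitute (powers ν) y V) ⟨
    length (extend [ powers ν , y ]′ V)         ∎
    where open ≡-Reasoning

  -- Over a one-letter alphabet a word is determined by its length, so equations are tested like
  -- `Length` atoms.
  unaryTest : (∀ c → c ≡ a) → EquationTest
  unaryTest all≡a = record
    { separator    = a
    ; Holds        = λ U V ν → skeleton ν U ≈ skeleton ν V
    ; recognizable = recognizable-≈
    ; sound        = λ ν {U} {V} _ _ U≈V y → word≡ _ _ (length-sound ν U V U≈V y)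
    ; complete     = λ κ x U V U≤κ V≤κ eq → length-complete a κ x U V U≤κ V≤κ (cong length eq)
    }
    where
    word≡ : ∀ (u v : Word A) → length u ≡ length v → u ≡ v
    word≡ []      []      eq = refl
    word≡ (c ∷ u) (d ∷ v) eq = cong₂ _∷_ (trans (all≡a c) (sym (all≡a d))) (word≡ u v (suc-injective eq))

  -- By the code property, an equation true at the generic words is an identity between substituted
  -- patterns, with universal variables as free letters. Erasing to `a` preserves identities.
  freeTest : ∀ {b} → b ≢ a → EquationTest
  freeTest {b} b≢a = record
    { separator    = b
    ; Holds        = λ U V ν → skeleton ν U ≡ skeleton ν V
    ; recognizable = recognizable-skeleton-≡
    ; sound        = λ ν {U} {V} onlyU onlyV eq y →
        trans (extend-skeleton ν onlyU y) (trans (cong (extend y) eq) (sym (extend-skeleton ν onlyV y)))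
    ; complete     = complete
    }
    where
    extend-skeleton : ∀ ν {U} → OnlyUses a U → ∀ y → extend [ powers ν , y ]′ U ≡ extend y (skeleton ν U)
    extend-skeleton ν {U} only y =
      trans (extend-substitute (powers ν) y U) (cong (extend y) (substitute-powers ν only))

    complete : ∀ κ x U V → length (substitute x U) ≤ κ → length (substitute x V) ≤ κ →
               let open Generic a b κ in
               extend [ x , generic ]′ U ≡ extend [ x , generic ]′ V →
               skeleton (lengths x) U ≡ skeleton (lengths x) V
    complete κ x U V U≤κ V≤κ eq = begin
      skeleton (lengths x) U ≡⟨ erase-substitute x U ⟨
      erase (substitute x U) ≡⟨ cong erase (extend-generic-injective _≟_ b≢a _ _ U≤κ V≤κ eq′) ⟩
      erase (substitute x V) ≡⟨ erase-substitute x V ⟩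
      skeleton (lengths x) V ∎
      where
      open Generic a b κ
      open ≡-Reasoning
      eq′ : extend generic (substitute x U) ≡ extend generic (substitute x V)
      eq′ = trans (sym (extend-substitute x generic U)) (trans eq (extend-substitute x generic V))

  -- The decision procedure

  -- Arguments of `Length` are read as patterns, so that the results on skeletons apply to both
  -- kinds of atoms.
  lengthPattern : ∀ {X : Set} → X ⊎ Word A → Pattern A X
  lengthPattern (inj₁ v) = [ inj₂ v ]
  lengthPattern (inj₂ u) = map inj₁ u

  extend-lengthPattern : ∀ {X : Set} (h : Assignment A X) z → extend h (lengthPattern z) ≡ [ h , id ]′ z
  extend-lengthPattern h (inj₁ v) = ++-identityʳ (h v)
  extend-lengthPattern h (inj₂ []) = refl
  extend-lengthPattern h (inj₂ (c ∷ u)) = cong (c ∷_) (extend-lengthPattern h (inj₂ u))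

  module Decide (test : EquationTest) where
    open EquationTest test

    Formula = PositiveFormula A (Fin n ⊎ Fin m)

    -- The quantifier over `y` is pushed down to the atoms, even through disjunctions;
    -- `UniversallyTrue-complete` justifies this.
    UniversallyTrue : Formula → Vec ℕ n → Set
    UniversallyTrue (U ≐ V)        ν = Holds U V ν
    UniversallyTrue (Length z₁ z₂) ν = skeleton ν (lengthPattern z₁) ≈ skeleton ν (lengthPattern z₂)
    UniversallyTrue (φ ∧ ψ)        ν = UniversallyTrue φ ν × UniversallyTrue ψ ν
    UniversallyTrue (φ ∨ ψ)        ν = UniversallyTrue φ ν ⊎ UniversallyTrue ψ ν

    recognizable-UniversallyTrue : ∀ φ → Recognizable (UniversallyTrue φ)
    recognizable-UniversallyTrue (U ≐ V)        = recognizable U V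
    recognizable-UniversallyTrue (Length z₁ z₂) = recognizable-≈ (lengthPattern z₁) (lengthPattern z₂)
    recognizable-UniversallyTrue (φ ∧ ψ)        =
      recognizable-× (recognizable-UniversallyTrue φ) (recognizable-UniversallyTrue ψ)
    recognizable-UniversallyTrue (φ ∨ ψ)        =
      recognizable-⊎ (recognizable-UniversallyTrue φ) (recognizable-UniversallyTrue ψ)

    UniversallyTrue-sound : ∀ φ → EquationsOnlyUse a φ → ∀ ν → UniversallyTrue φ ν →
                            ∀ y → [ powers ν , y ]′ ⊨ φ
    UniversallyTrue-sound (U ≐ V)        (onlyU , onlyV) ν holds y = sound ν onlyU onlyV holds y
    UniversallyTrue-sound (Length z₁ z₂) _               ν holds y = begin
      length ([ h , id ]′ z₁)             ≡⟨ cong length (extend-lengthPattern h z₁) ⟨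
      length (extend h (lengthPattern z₁)) ≡⟨ length-sound ν (lengthPattern z₁) (lengthPattern z₂) holds y ⟩
      length (extend h (lengthPattern z₂)) ≡⟨ cong length (extend-lengthPattern h z₂) ⟩
      length ([ h , id ]′ z₂)             ∎
      where
      open ≡-Reasoning
      h = [ powers ν , y ]′
    UniversallyTrue-sound (φ ∧ ψ) (onlyφ , onlyψ) ν (p , q) y =
      UniversallyTrue-sound φ onlyφ ν p y , UniversallyTrue-sound ψ onlyψ ν q y
    UniversallyTrue-sound (φ ∨ ψ) (onlyφ , onlyψ) ν (inj₁ p) y = inj₁ (UniversallyTrue-sound φ onlyφ ν p y)
    UniversallyTrue-sound (φ ∨ ψ) (onlyφ , onlyψ) ν (inj₂ q) y = inj₂ (UniversallyTrue-sound ψ onlyψ ν q y)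

    -- Summing over all atoms bounds every substituted side at once, so one `κ` and one generic `y`
    -- serve the whole formula.
    size : Assignment A (Fin n) → Formula → ℕ
    size x (U ≐ V)        = length (substitute x U) + length (substitute x V)
    size x (Length z₁ z₂) = length (substitute x (lengthPattern z₁)) + length (substitute x (lengthPattern z₂))
    size x (φ ∧ ψ)        = size x φ + size x ψ
    size x (φ ∨ ψ)        = size x φ + size x ψ

    -- The same generic `y` tests every atom: at a disjunction it selects a true disjunct, and truth
    -- there already amounts to truth for all `y`.
    UniversallyTrue-complete : ∀ κ x φ → size x φ ≤ κ →
      [ x , Generic.generic a separator κ ]′ ⊨ φ → UniversallyTrue φ (lengths x)
    UniversallyTrue-complete κ x (U ≐ V) ≤κ eq =
      complete κ x U V (m+n≤o⇒m≤o _ ≤κ) (m+n≤o⇒n≤o (length (substitute x U)) ≤κ) eq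
    UniversallyTrue-complete κ x (Length z₁ z₂) ≤κ eq =
      length-complete separator κ x (lengthPattern z₁) (lengthPattern z₂)
        (m+n≤o⇒m≤o _ ≤κ) (m+n≤o⇒n≤o (length (substitute x (lengthPattern z₁))) ≤κ)
        (trans (cong length (extend-lengthPattern h z₁))
               (trans eq (cong length (sym (extend-lengthPattern h z₂)))))
      where
      h = [ x , Generic.generic a separator κ ]′
    UniversallyTrue-complete κ x (φ ∧ ψ) ≤κ (p , q) =
      UniversallyTrue-complete κ x φ (m+n≤o⇒m≤o _ ≤κ) p ,
      UniversallyTrue-complete κ x ψ (m+n≤o⇒n≤o (size x φ) ≤κ) q
    UniversallyTrue-complete κ x (φ ∨ ψ) ≤κ (inj₁ p) =
      inj₁ (UniversallyTrue-complete κ x φ (m+n≤o⇒m≤o _ ≤κ) p)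
    UniversallyTrue-complete κ x (φ ∨ ψ) ≤κ (inj₂ q) =
      inj₂ (UniversallyTrue-complete κ x ψ (m+n≤o⇒n≤o (size x φ) ≤κ) q)

    true? : ∀ φ → EquationsOnlyUse a φ → Dec (True (∃∀ n m φ))
    true? φ only = Dec.map′
      (λ { (ν , holds) → powers ν , UniversallyTrue-sound φ only ν holds })
      -- The hypothesis is applied to a single `y`, the generic one whose `κ` is the size of the
      -- formula at `x`.
      (λ { (x , holds) → lengths x , UniversallyTrue-complete (size x φ) x φ ≤-refl (holds _) })
      (satisfiable? (recognizable-UniversallyTrue φ))

theorem5p3 : {A : Set} {k : ℕ} → A ↔ Fin k → (a : A) →
    (φ : PositiveΣ₂Sentence A) → EquationsOnlyUse a (matrix φ) → Dec (True φ)
theorem5p3 {A} A↔Fin a (∃∀ n m φ) only = Skeleton.Decide.true? _≟_ a test φ only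
  where
  _≟_ : DecidableEquality A
  _≟_ = via-injection (↔⇒↣ A↔Fin) Fin._≟_

  open Skeleton _≟_ a {n} {m} using (EquationTest; unaryTest; freeTest)
  open Inverse A↔Fin using (strictlyInverseʳ) renaming (to to index; from to letter)

  test : EquationTest
  -- A search through the finite alphabet either finds a letter other than `a` to act as separator
  -- or shows that `a` is the only letter.
  test with Fin.any? (λ i → ¬? (letter i ≟ a))
  ... | yes (i , b≢a) = freeTest b≢a
  ... | no  ∄b        = unaryTest (λ c → Dec.decidable-stable (c ≟ a)
                          (λ c≢a → ∄b (index c , λ c≡a → c≢a (trans (sym (strictlyInverseʳ c)) c≡a))))
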